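{- The Shrikhande graph (on 16 vertices and 48 edges) is not word-representable.
   Context: Graphs are finite, simple and undirected. Two distinct letters $x$ and $y$ alternate in a word $w$ if after deleting from $w$ all letters except the copies of $x$ and $y$ one obtains either a word $xyxy\cdots$ (of even or odd length) or a word $yxyx\cdots$ (of even or odd length). A graph $G=(V,E)$ is word-representable if there exists a (finite) word $w$ over the alphabet $V$, in which each letter of $V$ occurs at least once, such that for all distinct $x,y\in V$, the letters $x$ and $y$ alternate in $w$ if and only if $xy\in E$. The Shrikhande graph is the graph with vertex set $\{1,2,\ldots,16\}$ and the following 48 edges (written $a$-$b$): 1-2, 2-3, 3-4, 1-4; 1-5, 1-9, 1-8, 1-12; 2-5, 2-9, 2-6, 2-10; 3-6, 3-7, 3-10, 3-11; 4-8, 4-7, 4-12, 4-11; 8-9, 6-9, 6-11, 8-11; 5-10, 7-10, 7-12, 5-12; 13-14, 14-15, 15-16, 13-16; 5-13, 5-14, 11-13, 11-14; 9-15, 9-16, 7-15, 7-16; 8-13, 8-16, 10-13, 10-16; 6-14, 6-15, 12-14, 12-15. -}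

module Defs where

open import Data.Fin using (Fin; toℕ; _≟_)
open import Data.List using (List; []; _∷_; filter; length)
open import Data.List.Membership.Propositional using (_∈_)
open import Data.List.Relation.Unary.All using (All; all?; lookup)
open import Data.Nat using (ℕ; zero; suc)
import Data.Nat as ℕ
open import Data.Product using (_×_; _,_; ∃-syntax)
open import Data.Sum using (_⊎_; inj₁; inj₂; swap)
open import Function using (_⇔_)
open import Level using (0ℓ)
open import Relation.Binary using (Rel; Symmetric; Irreflexive)
open import Relation.Binary.PropositionalEquality using (_≡_; _≢_; refl)
open import Relation.Nullary.Decidable using (_⊎-dec_; ¬?; toWitness)

record Graph (n : ℕ) : Set₁ where
  field
    Adj    : Rel (Fin n) 0ℓ
    sym    : Symmetric Adj
    irrefl : Irreflexive _≡_ Adj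

Word : ℕ → Set
Word n = List (Fin n)

-- Delete all letters except the copies of x and y.
restrict : ∀ {n} → Fin n → Fin n → Word n → Word n
restrict x y = filter (λ z → (z ≟ x) ⊎-dec (z ≟ y))

-- alternating x y k is the word xyxy⋯ of length k.
alternating : ∀ {n} → Fin n → Fin n → ℕ → Word n
alternating x y zero    = []
alternating x y (suc k) = x ∷ alternating y x k

Alternate : ∀ {n} → Fin n → Fin n → Word n → Set
Alternate x y w =
  ∃[ k ] (restrict x y w ≡ alternating x y k ⊎ restrict x y w ≡ alternating y x k)

WordRepresentable : ∀ {n} → Graph n → Set
WordRepresentable {n} G =
  ∃[ w ] ((∀ (v : Fin n) → v ∈ w)
        × (∀ (x y : Fin n) → x ≢ y → Alternate x y w ⇔ Graph.Adj G x y))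

-- Each edge is listed once, in one orientation, with vertices numbered 1, …, 16.
shrikhandeEdges : List (ℕ × ℕ)
shrikhandeEdges =
  (1 , 2) ∷ (2 , 3) ∷ (3 , 4) ∷ (1 , 4) ∷
  (1 , 5) ∷ (1 , 9) ∷ (1 , 8) ∷ (1 , 12) ∷
  (2 , 5) ∷ (2 , 9) ∷ (2 , 6) ∷ (2 , 10) ∷
  (3 , 6) ∷ (3 , 7) ∷ (3 , 10) ∷ (3 , 11) ∷
  (4 , 8) ∷ (4 , 7) ∷ (4 , 12) ∷ (4 , 11) ∷
  (8 , 9) ∷ (6 , 9) ∷ (6 , 11) ∷ (8 , 11) ∷
  (5 , 10) ∷ (7 , 10) ∷ (7 , 12) ∷ (5 , 12) ∷
  (13 , 14) ∷ (14 , 15) ∷ (15 , 16) ∷ (13 , 16) ∷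
  (5 , 13) ∷ (5 , 14) ∷ (11 , 13) ∷ (11 , 14) ∷
  (9 , 15) ∷ (9 , 16) ∷ (7 , 15) ∷ (7 , 16) ∷
  (8 , 13) ∷ (8 , 16) ∷ (10 , 13) ∷ (10 , 16) ∷
  (6 , 14) ∷ (6 , 15) ∷ (12 , 14) ∷ (12 , 15) ∷ []

shrikhande-48-edges : length shrikhandeEdges ≡ 48
shrikhande-48-edges = refl

-- The element i of Fin 16 (counted from 0) stands for the vertex numbered i + 1.
label : Fin 16 → ℕ
label i = suc (toℕ i)

shrikhande-loopless : All (λ (a , b) → a ≢ b) shrikhandeEdges
shrikhande-loopless = toWitness {a? = all? (λ (a , b) → ¬? (a ℕ.≟ b)) shrikhandeEdges} _

shrikhande : Graph 16
shrikhande = record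
  { Adj    = λ x y → (label x , label y) ∈ shrikhandeEdges
                   ⊎ (label y , label x) ∈ shrikhandeEdges
  ; sym    = swap
  ; irrefl = λ { refl (inj₁ e) → lookup shrikhande-loopless e refl
               ; refl (inj₂ e) → lookup shrikhande-loopless e refl }
  }

{-# OPTIONS --safe #-}

-- Give an edge xy the sign +1 from x to y when x occurs first in the word.  Then x leads y:
-- in every prefix the number of x's equals, or exceeds by one, the number of y's.  If
-- a, b, c, d is a path of leaders and ad is an edge, then a and c alternate, and so do b and d.
-- Hence the signs around a 4-cycle that does not span a K₄ sum to 0.  The Shrikhande graph
-- triangulates the torus ℤ₄ × ℤ₄ without creating a K₄.  Two triangles sharing an edge form a
-- 4-cycle, so all triangles have the same sign sum up to orientation, and the straight lines
-- of the torus are 4-cycles as well.  One line in each of the three directions together bound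
-- a chain of triangles whose sign sums do not cancel; thus a triangle has sign sum 0, which
-- is impossible because that sum is odd.
module Submission where

open import Defs
open import Relation.Nullary using (¬_)
open import Data.Empty using (⊥-elim)
open import Data.Fin using (Fin; _≟_; #_)
open import Data.Integer using (ℤ; +_; -_; 0ℤ; 1ℤ; -1ℤ; _+_)
import Data.Integer.Properties as ℤ
open import Data.Integer.Tactic.RingSolver using (solve-∀)
open import Data.List using ([]; _∷_; filter; length; take)
open import Data.List.Membership.Propositional using (_∈_)
open import Data.List.Membership.Propositional.Properties using (∈-filter⁺)
import Data.List.Membership.DecPropositional as DecMembership
open import Data.List.Properties using (filter-accept; filter-reject; filter-≐; ∷-injective)
open import Data.Nat using (ℕ; zero; suc; _≤_; z≤n; s≤s; s≤s⁻¹)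
import Data.Nat as ℕ
open import Data.Nat.Properties using (≤-trans; m≤n⇒m≤1+n)
open import Data.Product using (_×_; _,_; proj₁; proj₂; ∃-syntax)
open import Data.Product.Properties using (≡-dec)
open import Data.Sum using (_⊎_; inj₁; inj₂; swap)
open import Function using (_∘_; _⇔_; mk⇔; Equivalence)
open import Relation.Binary.PropositionalEquality
  using (_≡_; _≢_; refl; sym; trans; cong; cong₂; subst; module ≡-Reasoning)
open import Relation.Nullary.Decidable
  using (Dec; yes; no; does; True; toWitness; _×-dec_; _⊎-dec_; ¬?; dec-true; dec-false)
open import Data.Bool using (if_then_else_)

open Equivalence using (to; from)

private variable
  n : ℕ
  x y z : Fin n
  w : Word n

-- Leading letters

occ : Fin n → Word n → ℕ
occ x w = length (filter (_≟ x) w)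

occ-here : ∀ (x : Fin n) w → occ x (x ∷ w) ≡ suc (occ x w)
occ-here x w = cong length (filter-accept (_≟ x) refl)

occ-there : z ≢ x → ∀ w → occ x (z ∷ w) ≡ occ x w
occ-there {x = x} z≢x w = cong length (filter-reject (_≟ x) z≢x)

-- Bounds on prefix counts, unlike restrictions to two letters, can be chained along a path of
-- edges.
Leads : Fin n → Fin n → Word n → Set
Leads x y w = ∀ k → occ y (take k w) ≤ occ x (take k w)
                  × occ x (take k w) ≤ suc (occ y (take k w))

-- The new `x` adds one to its count in every nonempty prefix, which turns each of the two bounds
-- into the other one with the roles exchanged: now it is the turn of `y`.
leads-here : x ≢ y → Leads x y (x ∷ w) ⇔ Leads y x w
leads-here {x = x} {y = y} {w = w} x≢y = mk⇔ forth back
  where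
  forth : Leads x y (x ∷ w) → Leads y x w
  forth l k with l (suc k)
  ... | p , q rewrite occ-here x (take k w) | occ-there x≢y (take k w) = s≤s⁻¹ q , p

  back : Leads y x w → Leads x y (x ∷ w)
  back l zero = z≤n , z≤n
  back l (suc k) rewrite occ-here x (take k w) | occ-there x≢y (take k w) =
    proj₂ (l k) , s≤s (proj₁ (l k))

leads-there : z ≢ x → z ≢ y → Leads x y (z ∷ w) ⇔ Leads x y w
leads-there {z = z} {x = x} {y = y} {w = w} z≢x z≢y = mk⇔ forth back
  where
  forth : Leads x y (z ∷ w) → Leads x y w
  forth l k with l (suc k)
  ... | p rewrite occ-there z≢x (take k w) | occ-there z≢y (take k w) = p

  back : Leads x y w → Leads x y (z ∷ w)
  back l zero = z≤n , z≤n
  back l (suc k) rewrite occ-there z≢x (take k w) | occ-there z≢y (take k w) = l k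

leads⇒¬here : x ≢ y → ¬ Leads x y (y ∷ w)
leads⇒¬here {x = x} {y = y} x≢y l with l 1
... | p , _ rewrite occ-here y [] | occ-there (x≢y ∘ sym) [] with () ← p

restrict-comm : ∀ (x y : Fin n) w → restrict x y w ≡ restrict y x w
restrict-comm x y = filter-≐ _ _ (swap , swap)

restrict-here : ∀ (x y : Fin n) w → restrict x y (x ∷ w) ≡ x ∷ restrict x y w
restrict-here x y w = filter-accept (λ z → (z ≟ x) ⊎-dec (z ≟ y)) (inj₁ refl)

restrict-there : z ≢ x → z ≢ y → ∀ w → restrict x y (z ∷ w) ≡ restrict x y w
restrict-there {x = x} {y = y} z≢x z≢y w =
  filter-reject (λ z → (z ≟ x) ⊎-dec (z ≟ y)) λ { (inj₁ e) → z≢x e ; (inj₂ e) → z≢y e }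

alternating⇒leads : x ≢ y → ∀ w k → restrict x y w ≡ alternating x y k → Leads x y w
alternating⇒leads x≢y [] k e zero = z≤n , z≤n
alternating⇒leads x≢y [] k e (suc _) = z≤n , z≤n
alternating⇒leads {x = x} {y = y} x≢y (z ∷ w) k e with z ≟ x | z ≟ y
alternating⇒leads {x = x} {y = y} x≢y (z ∷ w) (suc k) e | yes refl | _ =
  from (leads-here x≢y)
    (alternating⇒leads (x≢y ∘ sym) w k
      (trans (restrict-comm y x w) (proj₂ (∷-injective e))))
... | no z≢x | no z≢y = from (leads-there z≢x z≢y) (alternating⇒leads x≢y w k e)
alternating⇒leads x≢y (z ∷ w) (suc k) e | no z≢x | yes _ =
  ⊥-elim (z≢x (proj₁ (∷-injective e)))

leads⇒alternating : x ≢ y → ∀ w → Leads x y w → ∃[ k ] restrict x y w ≡ alternating x y k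
leads⇒alternating x≢y [] l = 0 , refl
leads⇒alternating {x = x} {y = y} x≢y (z ∷ w) l with z ≟ x
... | yes refl =
  let k , e = leads⇒alternating (x≢y ∘ sym) w (to (leads-here x≢y) l)
  in suc k , cong (x ∷_) (trans (restrict-comm x y w) e)
... | no z≢x with z ≟ y
...   | yes refl = ⊥-elim (leads⇒¬here x≢y l)
...   | no z≢y = leads⇒alternating x≢y w (to (leads-there z≢x z≢y) l)

-- Signs of edges

headSign : Fin n → Word n → ℤ
headSign x [] = 0ℤ
headSign x (z ∷ _) = if does (z ≟ x) then 1ℤ else -1ℤ

sign : Word n → Fin n → Fin n → ℤ
sign w x y = headSign x (restrict x y w)

-- Splitting on the direction of an edge thus yields at once both numerical signs and the
-- inequalities on prefixes.
Leading : Word n → Fin n → Fin n → Set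
Leading w x y = sign w x y ≡ 1ℤ × sign w y x ≡ -1ℤ × Leads x y w

alternating⇒leading : x ≢ y → x ∈ w → ∀ k → restrict x y w ≡ alternating x y k → Leading w x y
-- Since `x` occurs in `w`, it survives the restriction; so there is a first letter and the sign is
-- not the default `0ℤ`.
alternating⇒leading {x = x} {y = y} {w = w} x≢y x∈w zero e
  with () ← subst (x ∈_) e (∈-filter⁺ (λ z → (z ≟ x) ⊎-dec (z ≟ y)) x∈w (inj₁ refl))
alternating⇒leading {x = x} {y = y} {w = w} x≢y x∈w (suc k) e =
  trans (cong (headSign x) e) head-x ,
  trans (cong (headSign y) (trans (restrict-comm y x w) e)) head-y ,
  alternating⇒leads x≢y w (suc k) e
  where
  head-x : headSign x (alternating x y (suc k)) ≡ 1ℤ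
  head-x rewrite dec-true (x ≟ x) refl = refl

  head-y : headSign y (alternating x y (suc k)) ≡ -1ℤ
  head-y rewrite dec-false (x ≟ y) x≢y = refl

alternate⇒leading : x ≢ y → x ∈ w → y ∈ w → Alternate x y w → Leading w x y ⊎ Leading w y x
alternate⇒leading x≢y x∈w y∈w (k , inj₁ e) = inj₁ (alternating⇒leading x≢y x∈w k e)
alternate⇒leading {x = x} {y = y} {w = w} x≢y x∈w y∈w (k , inj₂ e) =
  inj₂ (alternating⇒leading (x≢y ∘ sym) y∈w k (trans (restrict-comm y x w) e))

-- Sign sums around triangles and 4-cycles

module Signed {n : ℕ} (G : Graph n) (w : Word n) (occurs : ∀ v → v ∈ w)
  (represents : ∀ x y → x ≢ y → Alternate x y w ⇔ Graph.Adj G x y) where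

  open Graph G renaming (sym to Adj-sym)

  adj⇒≢ : Adj x y → x ≢ y
  adj⇒≢ xy x≡y = irrefl x≡y xy

  orient : Adj x y → Leading w x y ⊎ Leading w y x
  orient {x} {y} xy =
    alternate⇒leading (adj⇒≢ xy) (occurs x) (occurs y) (from (represents x y (adj⇒≢ xy)) xy)

  leads⇒adj : x ≢ y → Leads x y w → Adj x y
  leads⇒adj {x} {y} x≢y l =
    let k , e = leads⇒alternating x≢y w l in to (represents x y x≢y) (k , inj₁ e)

  s : Fin n → Fin n → ℤ
  s = sign w

  sign-antisym : Adj x y → s y x ≡ - s x y
  sign-antisym xy with orient xy
  ... | inj₁ (p , q , _) rewrite p | q = refl
  ... | inj₂ (p , q , _) rewrite p | q = refl

  -- One diagonal may be an edge, so that two triangles with a common side qualify.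
  FourCycle : (a b c d : Fin n) → Set
  FourCycle a b c d =
    (Adj a b × Adj b c × Adj c d × Adj d a) × (a ≢ c × b ≢ d) × ¬ (Adj a c × Adj b d)

  -- In each prefix the counts satisfy d ≤ c ≤ b ≤ a, and the edge between `a` and `d` gives a ≤ 1 +
  -- d whichever of its ends leads. So any two of the four counts differ by at most one.
  shortcut : ∀ {a b c d} → a ≢ c → b ≢ d →
             Leading w a b → Leading w b c → Leading w c d → Leading w a d ⊎ Leading w d a →
             Adj a c × Adj b d
  shortcut {a} {b} {c} {d} a≢c b≢d (_ , _ , ab) (_ , _ , bc) (_ , _ , cd) ad =
    leads⇒adj a≢c (λ k →
      ≤-trans (proj₁ (bc k)) (proj₁ (ab k)) , ≤-trans (a≤1+d ad k) (s≤s (proj₁ (cd k)))) ,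
    leads⇒adj b≢d (λ k →
      ≤-trans (proj₁ (cd k)) (proj₁ (bc k)) , ≤-trans (proj₁ (ab k)) (a≤1+d ad k))
    where
    a≤1+d : Leading w a d ⊎ Leading w d a → ∀ k → occ a (take k w) ≤ suc (occ d (take k w))
    a≤1+d (inj₁ (_ , _ , l)) k = proj₂ (l k)
    a≤1+d (inj₂ (_ , _ , l)) k = m≤n⇒m≤1+n (proj₁ (l k))

  quad : (a b c d : Fin n) → ℤ
  quad a b c d = s a b + s b c + s c d + s d a

  -- In ten of the sixteen orientations three consecutive edges point the same way around, and
  -- `shortcut`, started at a suitable vertex and direction, yields both diagonals. The other six
  -- have two edges each way.
  quad≡0 : ∀ {a b c d} → FourCycle a b c d → quad a b c d ≡ 0ℤ
  quad≡0 {a} {b} {c} {d} ((ab , bc , cd , da) , (a≢c , b≢d) , ¬K₄)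
    with orient ab | orient bc | orient cd | orient da
  ... | inj₁ p | inj₁ q | inj₁ r | t = ⊥-elim (¬K₄ (shortcut a≢c b≢d p q r (swap t)))
  ... | inj₂ p | inj₂ q | inj₂ r | t =
    let db , ca = shortcut (b≢d ∘ sym) (a≢c ∘ sym) r q p t
    in ⊥-elim (¬K₄ (Adj-sym ca , Adj-sym db))
  ... | inj₁ p | inj₁ q | inj₂ r | inj₁ t =
    let db , ac = shortcut (b≢d ∘ sym) a≢c t p q (inj₁ r) in ⊥-elim (¬K₄ (ac , Adj-sym db))
  ... | inj₁ p | inj₂ q | inj₁ r | inj₁ t =
    let ca , db = shortcut (a≢c ∘ sym) (b≢d ∘ sym) r t p (inj₁ q)
    in ⊥-elim (¬K₄ (Adj-sym ca , Adj-sym db))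
  ... | inj₂ p | inj₁ q | inj₁ r | inj₁ t =
    let bd , ca = shortcut b≢d (a≢c ∘ sym) q r t (inj₁ p) in ⊥-elim (¬K₄ (Adj-sym ca , bd))
  ... | inj₂ p | inj₂ q | inj₁ r | inj₂ t =
    let ca , bd = shortcut (a≢c ∘ sym) b≢d q p t (inj₁ r) in ⊥-elim (¬K₄ (Adj-sym ca , bd))
  ... | inj₂ p | inj₁ q | inj₂ r | inj₂ t =
    ⊥-elim (¬K₄ (let bd , ac = shortcut b≢d a≢c p t r (inj₁ q) in ac , bd))
  ... | inj₁ p | inj₂ q | inj₂ r | inj₂ t =
    let ac , db = shortcut a≢c (b≢d ∘ sym) t r q (inj₁ p) in ⊥-elim (¬K₄ (ac , Adj-sym db))
  ... | inj₁ (p , _) | inj₁ (q , _) | inj₂ (_ , r , _) | inj₂ (_ , t , _)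
    rewrite p | q | r | t = refl
  ... | inj₁ (p , _) | inj₂ (_ , q , _) | inj₁ (r , _) | inj₂ (_ , t , _)
    rewrite p | q | r | t = refl
  ... | inj₁ (p , _) | inj₂ (_ , q , _) | inj₂ (_ , r , _) | inj₁ (t , _)
    rewrite p | q | r | t = refl
  ... | inj₂ (_ , p , _) | inj₁ (q , _) | inj₁ (r , _) | inj₂ (_ , t , _)
    rewrite p | q | r | t = refl
  ... | inj₂ (_ , p , _) | inj₁ (q , _) | inj₂ (_ , r , _) | inj₁ (t , _)
    rewrite p | q | r | t = refl
  ... | inj₂ (_ , p , _) | inj₂ (_ , q , _) | inj₁ (r , _) | inj₁ (t , _)
    rewrite p | q | r | t = refl

  triangle : (a b c : Fin n) → ℤ
  triangle a b c = s a b + s b c + s c a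

  triangle-rotate : ∀ a b c → triangle a b c ≡ triangle b c a
  triangle-rotate a b c = rotate (s a b) (s b c) (s c a)
    where
    rotate : ∀ i j k → i + j + k ≡ j + k + i
    rotate = solve-∀

  -- The difference of the two sums is `quad a b c d`. The shared side keeps its direction, so the
  -- two triangles have opposite orientations on the torus.
  triangle-flip : ∀ {a b c d} → FourCycle a b c d → triangle a b c ≡ triangle a d c
  triangle-flip {a} {b} {c} {d} cyc@((_ , _ , cd , da) , _) = begin
    s a b + s b c + s c a                            ≡⟨ split (s a b) (s b c) (s c d) (s d a) (s c a) ⟩
    quad a b c d + (- s d a + - s c d + s c a)       ≡⟨ cong (_+ _) (quad≡0 cyc) ⟩
    0ℤ + (- s d a + - s c d + s c a)                 ≡⟨ ℤ.+-identityˡ _ ⟩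
    - s d a + - s c d + s c a
      ≡⟨ cong₂ (λ i j → i + j + s c a) (sym (sign-antisym da)) (sym (sign-antisym cd)) ⟩
    s a d + s d c + s c a                            ∎
    where
    open ≡-Reasoning
    split : ∀ i j k l m → i + j + m ≡ i + j + k + l + (- l + - k + m)
    split = solve-∀

  -- Three terms ±1 have an odd sum; the eight cases evaluate to ±1 or ±3.
  triangle≢0 : ∀ {a b c} → Adj a b → Adj b c → Adj c a → triangle a b c ≢ 0ℤ
  triangle≢0 ab bc ca e with orient ab | orient bc | orient ca
  ... | inj₁ (p , _)     | inj₁ (q , _)     | inj₁ (r , _)     rewrite p | q | r with () ← e
  ... | inj₁ (p , _)     | inj₁ (q , _)     | inj₂ (_ , r , _) rewrite p | q | r with () ← e
  ... | inj₁ (p , _)     | inj₂ (_ , q , _) | inj₁ (r , _)     rewrite p | q | r with () ← e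
  ... | inj₁ (p , _)     | inj₂ (_ , q , _) | inj₂ (_ , r , _) rewrite p | q | r with () ← e
  ... | inj₂ (_ , p , _) | inj₁ (q , _)     | inj₁ (r , _)     rewrite p | q | r with () ← e
  ... | inj₂ (_ , p , _) | inj₁ (q , _)     | inj₂ (_ , r , _) rewrite p | q | r with () ← e
  ... | inj₂ (_ , p , _) | inj₂ (_ , q , _) | inj₁ (r , _)     rewrite p | q | r with () ← e
  ... | inj₂ (_ , p , _) | inj₂ (_ , q , _) | inj₂ (_ , r , _) rewrite p | q | r with () ← e

  hexagon : (p x q y r z : Fin n) → ℤ
  hexagon p x q y r z = s p x + s x q + s q y + s y r + s r z + s z p

  -- x, y, z are the midpoints of the sides of the triangle p q r of side length 2.
  hexagon-medial : ∀ {p x q y r z} →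
                   FourCycle p x y z → FourCycle q y z x → FourCycle r z x y →
                   hexagon p x q y r z + (triangle x y z + triangle x y z) ≡ 0ℤ
  hexagon-medial {p} {x} {q} {y} {r} {z} P Q R = begin
    hexagon p x q y r z + (triangle x y z + triangle x y z)
      -- Each 4-cycle surrounds a corner triangle and the middle one, so every side of the middle
      -- triangle is traversed by two of the three.
      ≡⟨ regroup (s p x) (s x q) (s q y) (s y r) (s r z) (s z p) (s x y) (s y z) (s z x) ⟩
    quad p x y z + quad q y z x + quad r z x y
      ≡⟨ cong₂ _+_ (cong₂ _+_ (quad≡0 P) (quad≡0 Q)) (quad≡0 R) ⟩
    0ℤ ∎
    where
    open ≡-Reasoning
    regroup : ∀ px xq qy yr rz zp xy yz zx →
              px + xq + qy + yr + rz + zp + (xy + yz + zx + (xy + yz + zx))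
              ≡ px + xy + yz + zp + (qy + yz + zx + xq) + (rz + zx + xy + yr)
    regroup = solve-∀

  -- The lines p x q x′, q y r y′ and r z p z′ split into the two hexagons.
  hexagon-lines : ∀ {p x q y r z x′ y′ z′} →
                  FourCycle p x q x′ → FourCycle q y r y′ → FourCycle r z p z′ →
                  hexagon p x q y r z + hexagon p z′ r y′ q x′ ≡ 0ℤ
  hexagon-lines {p} {x} {q} {y} {r} {z} {x′} {y′} {z′} X Y Z = begin
    hexagon p x q y r z + hexagon p z′ r y′ q x′
      ≡⟨ regroup (s p x) (s x q) (s q y) (s y r) (s r z) (s z p)
                 (s p z′) (s z′ r) (s r y′) (s y′ q) (s q x′) (s x′ p) ⟩
    quad p x q x′ + quad q y r y′ + quad r z p z′
      ≡⟨ cong₂ _+_ (cong₂ _+_ (quad≡0 X) (quad≡0 Y)) (quad≡0 Z) ⟩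
    0ℤ ∎
    where
    open ≡-Reasoning
    regroup : ∀ px xq qy yr rz zp pz zr ry yq qx xp →
              px + xq + qy + yr + rz + zp + (pz + zr + ry + yq + qx + xp)
              ≡ px + xq + qx + xp + (qy + yr + ry + yq) + (rz + zp + pz + zr)
    regroup = solve-∀

-- The Shrikhande graph

open Graph shrikhande using (Adj)
open DecMembership (≡-dec ℕ._≟_ ℕ._≟_) using (_∈?_)

adj? : ∀ x y → Dec (Adj x y)
adj? x y = ((label x , label y) ∈? shrikhandeEdges) ⊎-dec ((label y , label x) ∈? shrikhandeEdges)

i+i≡0⇒i≡0 : ∀ i → i + i ≡ 0ℤ → i ≡ 0ℤ
i+i≡0⇒i≡0 (+ zero) _ = refl

mainTheorem2 : ¬ WordRepresentable shrikhande
mainTheorem2 (w , occurs , represents) =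
  -- Halving 4t = 0 twice gives t = 0.
  triangle≢0 {v8} {v16} {v9} (edge v8 v16) (edge v16 v9) (edge v9 v8)
    (i+i≡0⇒i≡0 _ (i+i≡0⇒i≡0 _ four-triangles))
  where
  open Signed shrikhande w occurs represents
  open ≡-Reasoning

  v1 v5 v8 v9 v11 v12 v13 v14 v15 v16 : Fin 16
  v1 = # 0
  v5 = # 4
  v8 = # 7
  v9 = # 8
  v11 = # 10
  v12 = # 11
  v13 = # 12
  v14 = # 13
  v15 = # 14
  v16 = # 15

  edge : ∀ x y → {True (adj? x y)} → Adj x y
  edge x y {t} = toWitness t

  fourCycle? : ∀ a b c d → Dec (FourCycle a b c d)
  fourCycle? a b c d =
    (adj? a b ×-dec adj? b c ×-dec adj? c d ×-dec adj? d a)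
    ×-dec (¬? (a ≟ c) ×-dec ¬? (b ≟ d))
    ×-dec ¬? (adj? a c ×-dec adj? b d)

  cycle : ∀ a b c d → {True (fourCycle? a b c d)} → FourCycle a b c d
  cycle a b c d {t} = toWitness t

  -- A walk across the sides 8-16, 8-13, 11-13, 13-14 and 5-14; the rotations bring the next shared
  -- side into position. Five flips, an odd number, reverse the orientation on the torus, which is
  -- why the two hexagons below do not cancel.
  triangles-agree : triangle v12 v14 v5 ≡ triangle v8 v16 v9
  triangles-agree = sym (begin
    triangle v8 v16 v9    ≡⟨ triangle-rotate v8 v16 v9 ⟩
    triangle v16 v9 v8    ≡⟨ triangle-flip (cycle v16 v9 v8 v13) ⟩
    triangle v16 v13 v8   ≡⟨ triangle-rotate v8 v16 v13 ⟨
    triangle v8 v16 v13   ≡⟨ triangle-flip (cycle v8 v16 v13 v11) ⟩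
    triangle v8 v11 v13   ≡⟨ triangle-rotate v13 v8 v11 ⟨
    triangle v13 v8 v11   ≡⟨ triangle-flip (cycle v13 v8 v11 v14) ⟩
    triangle v13 v14 v11  ≡⟨ triangle-rotate v13 v14 v11 ⟩
    triangle v14 v11 v13  ≡⟨ triangle-flip (cycle v14 v11 v13 v5) ⟩
    triangle v14 v5 v13   ≡⟨ triangle-rotate v14 v5 v13 ⟩
    triangle v5 v13 v14   ≡⟨ triangle-flip (cycle v5 v13 v14 v12) ⟩
    triangle v5 v12 v14   ≡⟨ triangle-rotate v5 v12 v14 ⟩
    triangle v12 v14 v5   ∎)

  -- Both hexagons equal -2t by `hexagon-medial`, the second one via `triangles-agree`, while the
  -- lines make their sum 0.
  four-triangles : let t = triangle v8 v16 v9 in (t + t) + (t + t) ≡ 0ℤ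
  four-triangles = begin
    (t + t) + (t + t)
      ≡⟨ ℤ.+-identityˡ _ ⟨
    0ℤ + ((t + t) + (t + t))
      ≡⟨ cong (_+ ((t + t) + (t + t))) lines ⟨
    h + h′ + ((t + t) + (t + t))
      ≡⟨ interchange h h′ (t + t) (t + t) ⟩
    (h + (t + t)) + (h′ + (t + t))
      ≡⟨ cong₂ _+_ medial (subst (λ u → h′ + (u + u) ≡ 0ℤ) triangles-agree medial′) ⟩
    0ℤ ∎
    where
    t = triangle v8 v16 v9
    h = hexagon v1 v8 v13 v16 v15 v9
    h′ = hexagon v1 v12 v15 v14 v13 v5

    interchange : ∀ i j k l → i + j + (k + l) ≡ (i + k) + (j + l)
    interchange = solve-∀

    lines : h + h′ ≡ 0ℤ
    -- Three lines of different directions that meet pairwise in the corners 1, 13 and 15.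
    lines = hexagon-lines (cycle v1 v8 v13 v5) (cycle v13 v16 v15 v14) (cycle v15 v9 v1 v12)

    medial : h + (t + t) ≡ 0ℤ
    medial = hexagon-medial (cycle v1 v8 v16 v9) (cycle v13 v16 v9 v8) (cycle v15 v9 v8 v16)

    medial′ : h′ + (triangle v12 v14 v5 + triangle v12 v14 v5) ≡ 0ℤ
    medial′ = hexagon-medial (cycle v1 v12 v14 v5) (cycle v15 v14 v5 v12) (cycle v13 v5 v12 v14)
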